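{- Let $(c_n(\lambda))_{n\ge 0}$ be the sequence of polynomials in $\lambda$ defined by $c_0(\lambda)=1$ and, for $n\ge 1$, $$c_{n}(\lambda) = (3-\lambda)c_{n-1}(\lambda) - \sum_{i=2}^{n}(-1)^{i}(2^{i+1}-1)c_{n-i}(\lambda).$$ Then for all $n\ge 0$, $$c_{n}(\lambda) = \sum_{t=0}^{n}\left(\sum_{\ell=0}^{t}\binom{t}{\ell}(-1)^{t}2^{t-\ell}3^{n+2\ell-3t-2}\left[2\binom{\ell}{n+2\ell-3t-2}+9\binom{\ell+1}{n+2\ell-3t}\right]\right) \lambda^{t}.$$
   Context: Empty sums are $0$. Binomial coefficients $\binom{a}{b}$ with $a\ge 0$ are $0$ when $b<0$ or $b>a$. Powers of $3$ with negative exponents are rational numbers. -}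

module Defs where

open import Algebra.Bundles using (RawMonoid; RawRing)
import Algebra.Definitions.RawSemiring as RawSemiringDefs
open import Data.Integer.Base using (ℤ; +_; -[1+_])
open import Data.List.Base using (List; []; _∷_; map; foldr; applyUpTo)
open import Data.Nat.Base using (ℕ; zero; suc; _∸_)
import Data.Nat.Base as ℕ
open import Data.Nat.Combinatorics using (_C_)
open import Data.Rational.Base as ℚ using (ℚ; 0ℚ; 1ℚ; 1/_; _/_)
open import Level using (0ℓ)
open import Relation.Binary.PropositionalEquality using (_≡_)

ι : ℤ → ℚ
ι z = z / 1

open RawSemiringDefs ℚ.+-*-rawSemiring public using () renaming (_^_ to _^ℚ_)

infixr 8 _^ℤ_

_^ℤ_ : (q : ℚ) .{{_ : ℚ.NonZero q}} → ℤ → ℚ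
q ^ℤ (+ n)    = q ^ℚ n
q ^ℤ -[1+ n ] = (1/ q) ^ℚ suc n

-- _C_ is already 0 when the lower index exceeds the upper one.
binom : ℕ → ℤ → ℕ
binom a (+ b)    = a C b
binom a -[1+ _ ] = 0

-- A list of coefficients, constant term first.  Trailing zeros are allowed,
-- so polynomials are compared by _≈_ and not by _≡_.
ℚ[λ] : Set
ℚ[λ] = List ℚ

coeff : ℚ[λ] → ℕ → ℚ
coeff []      _       = 0ℚ
coeff (a ∷ p) zero    = a
coeff (a ∷ p) (suc k) = coeff p k

infix  4 _≈_
infixl 6 _+ₚ_ _-ₚ_
infixl 7 _*ₚ_
infix  8 -ₚ_

_≈_ : ℚ[λ] → ℚ[λ] → Set
p ≈ q = ∀ k → coeff p k ≡ coeff q k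

_+ₚ_ : ℚ[λ] → ℚ[λ] → ℚ[λ]
[]      +ₚ q       = q
(a ∷ p) +ₚ []      = a ∷ p
(a ∷ p) +ₚ (b ∷ q) = (a ℚ.+ b) ∷ (p +ₚ q)

-ₚ_ : ℚ[λ] → ℚ[λ]
-ₚ_ = map (ℚ.-_)

_-ₚ_ : ℚ[λ] → ℚ[λ] → ℚ[λ]
p -ₚ q = p +ₚ (-ₚ q)

-- (a + λ p) q = a q + λ (p q)
_*ₚ_ : ℚ[λ] → ℚ[λ] → ℚ[λ]
[]      *ₚ q = []
(a ∷ p) *ₚ q = map (a ℚ.*_) q +ₚ (0ℚ ∷ (p *ₚ q))

const : ℚ → ℚ[λ]
const a = a ∷ []

-- The indeterminate λ, whose own name is reserved in Agda.
X : ℚ[λ]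
X = 0ℚ ∷ 1ℚ ∷ []

ℚ[λ]-rawRing : RawRing 0ℓ 0ℓ
ℚ[λ]-rawRing = record
  { Carrier = ℚ[λ]
  ; _≈_     = _≈_
  ; _+_     = _+ₚ_
  ; _*_     = _*ₚ_
  ; -_      = -ₚ_
  ; 0#      = []
  ; 1#      = const 1ℚ
  }

open RawRing ℚ[λ]-rawRing public using () renaming (1# to 1ₚ; +-rawMonoid to +ₚ-rawMonoid)
open RawSemiringDefs (RawRing.rawSemiring ℚ[λ]-rawRing) public using () renaming (_^_ to _^ₚ_)

-- f a + f (a + 1) + ... + f b, which is empty when b < a.
sumFromTo : ∀ {c ℓ} (M : RawMonoid c ℓ) → ℕ → ℕ →
            (ℕ → RawMonoid.Carrier M) → RawMonoid.Carrier M
sumFromTo M a b f = foldr _∙_ ε (applyUpTo (λ k → f (a ℕ.+ k)) (suc b ∸ a))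
  where open RawMonoid M

sumℚ : ℕ → ℕ → (ℕ → ℚ) → ℚ
sumℚ = sumFromTo ℚ.+-0-rawMonoid

sumₚ : ℕ → ℕ → (ℕ → ℚ[λ]) → ℚ[λ]
sumₚ = sumFromTo +ₚ-rawMonoid

infix 5 sumℚ sumₚ

syntax sumℚ a b (λ i → x) = ∑ℚ[ i from a to b ] x
syntax sumₚ a b (λ i → p) = ∑ₚ[ i from a to b ] p

{-# OPTIONS --safe #-}

-- With γᵢ = (-1)ⁱ(2ⁱ⁺¹ - 1), the recurrence says C(x) (λx + Σ γᵢ xⁱ) = 1 for the
-- generating function C(x) = Σ cₙ xⁿ, and Σ γᵢ xⁱ = 1/P with P = (1 + x)(1 + 2x) = 1 + 3x + 2x².
-- Hence the coefficient of λᵗ in C is (-x)ᵗ Pᵗ⁺¹, so that passing from t to t + 1 multiplies it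
-- by -x P.  The closed form expands Pᵗ⁺¹ = Pᵗ ((1 + 3x) + 2x²) in powers of 1 + 3x and 2x²;
-- it satisfies the same rule in t, with x-exponents allowed to be arbitrary integers.

module Submission where

open import Defs
open import Data.Nat.Base as ℕ using (ℕ; zero; suc; _∸_; _≤_; s≤s; z≤n)
import Data.Nat.Properties as ℕ
open import Data.Nat.Combinatorics using (_C_; k>n⇒nCk≡0; nCk+nC[k+1]≡[n+1]C[k+1])
open import Data.Integer.Base as ℤ using (ℤ; +_; -[1+_]; -1ℤ; 1ℤ)
import Data.Integer.Properties as ℤ
import Data.Integer.Solver as ℤSolver
open import Data.List.Base using ([]; _∷_; foldr; map; applyUpTo)
open import Data.Rational.Base as ℚ using (ℚ; 0ℚ; 1ℚ; toℚᵘ)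
import Data.Rational.Properties as ℚ
import Data.Rational.Solver as ℚSolver
open import Data.Rational.Unnormalised.Base as ℚᵘ using (mkℚᵘ; *≡*)
import Data.Rational.Unnormalised.Properties as ℚᵘ
open import Function.Base using (_∘_)
open import Relation.Binary.PropositionalEquality using (_≡_; _≢_; refl; sym; trans; cong; cong₂; module ≡-Reasoning)
open import Relation.Nullary using (yes; no)

open ≡-Reasoning

private
  module ℤR = ℤSolver.+-*-Solver
  module ℚR = ℚSolver.+-*-Solver

-- Embedding the integers into the rationals.

2ℚ 3ℚ 9ℚ : ℚ
2ℚ = ι (+ 2)
3ℚ = ι (+ 3)
9ℚ = ι (+ 9)

-- `ι` reduces fractions to lowest terms and so does not compute on variables. In the unnormalised
-- rationals equality is cross-multiplication, here with all denominators 1, which leaves an integer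
-- identity.
ι-homo-+ : ∀ i j → ι (i ℤ.+ j) ≡ ι i ℚ.+ ι j
ι-homo-+ i j = ℚ.toℚᵘ-injective (begin′
  toℚᵘ (ι (i ℤ.+ j))        ≈⟨ ℚ.toℚᵘ-fromℚᵘ (mkℚᵘ (i ℤ.+ j) 0) ⟩
  mkℚᵘ (i ℤ.+ j) 0          ≈⟨ *≡* (ℤR.solve 2 (λ i j → (i ℤR.:+ j) ℤR.:* one ℤR.:=
                                 (i ℤR.:* one ℤR.:+ j ℤR.:* one) ℤR.:* one) refl i j) ⟩
  mkℚᵘ i 0 ℚᵘ.+ mkℚᵘ j 0    ≈⟨ ℚᵘ.+-cong (ℚ.toℚᵘ-fromℚᵘ (mkℚᵘ i 0)) (ℚ.toℚᵘ-fromℚᵘ (mkℚᵘ j 0)) ⟨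
  toℚᵘ (ι i) ℚᵘ.+ toℚᵘ (ι j) ≈⟨ ℚ.toℚᵘ-homo-+ (ι i) (ι j) ⟨
  toℚᵘ (ι i ℚ.+ ι j)        ∎′)
  where
  open import Relation.Binary.Reasoning.Setoid ℚᵘ.≃-setoid
    using (step-≈-⟩; step-≈-⟨) renaming (begin_ to begin′_; _∎ to _∎′)
  one : ∀ {n} → ℤR.Polynomial n
  one = ℤR.con 1ℤ

ι-homo-* : ∀ i j → ι (i ℤ.* j) ≡ ι i ℚ.* ι j
ι-homo-* i j = ℚ.toℚᵘ-injective (begin′
  toℚᵘ (ι (i ℤ.* j))        ≈⟨ ℚ.toℚᵘ-fromℚᵘ (mkℚᵘ (i ℤ.* j) 0) ⟩
  mkℚᵘ i 0 ℚᵘ.* mkℚᵘ j 0    ≈⟨ ℚᵘ.*-cong (ℚ.toℚᵘ-fromℚᵘ (mkℚᵘ i 0)) (ℚ.toℚᵘ-fromℚᵘ (mkℚᵘ j 0)) ⟨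
  toℚᵘ (ι i) ℚᵘ.* toℚᵘ (ι j) ≈⟨ ℚ.toℚᵘ-homo-* (ι i) (ι j) ⟨
  toℚᵘ (ι i ℚ.* ι j)        ∎′)
  where
  open import Relation.Binary.Reasoning.Setoid ℚᵘ.≃-setoid
    using (step-≈-⟩; step-≈-⟨) renaming (begin_ to begin′_; _∎ to _∎′)

-- Finite sums of rationals.

-- Indexed by the number of terms: a sum from 0 to n unfolds to `sum (suc n)`, and a sum from 2 to n
-- + 1 to `sum n` with the index shifted by 2.
sum : ℕ → (ℕ → ℚ) → ℚ
sum n f = foldr ℚ._+_ 0ℚ (applyUpTo f n)

sum-cong : ∀ n {f g : ℕ → ℚ} → (∀ i → i ℕ.< n → f i ≡ g i) → sum n f ≡ sum n g
sum-cong zero    f≗g = refl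
sum-cong (suc n) f≗g = cong₂ ℚ._+_ (f≗g 0 (s≤s z≤n)) (sum-cong n λ i i<n → f≗g (suc i) (s≤s i<n))

sum-zero : ∀ n {f : ℕ → ℚ} → (∀ i → i ℕ.< n → f i ≡ 0ℚ) → sum n f ≡ 0ℚ
sum-zero zero    f≗0 = refl
sum-zero (suc n) f≗0 = cong₂ ℚ._+_ (f≗0 0 (s≤s z≤n)) (sum-zero n λ i i<n → f≗0 (suc i) (s≤s i<n))

sum-last : ∀ n (f : ℕ → ℚ) → sum (suc n) f ≡ sum n f ℚ.+ f n
sum-last zero    f = ℚ.+-comm (f 0) 0ℚ
sum-last (suc n) f = begin
  f 0 ℚ.+ sum (suc n) (f ∘ suc)             ≡⟨ cong (f 0 ℚ.+_) (sum-last n (f ∘ suc)) ⟩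
  f 0 ℚ.+ (sum n (f ∘ suc) ℚ.+ f (suc n))   ≡⟨ ℚ.+-assoc (f 0) _ _ ⟨
  f 0 ℚ.+ sum n (f ∘ suc) ℚ.+ f (suc n)     ∎

sum-+ : ∀ n (f g : ℕ → ℚ) → sum n (λ i → f i ℚ.+ g i) ≡ sum n f ℚ.+ sum n g
sum-+ zero    f g = refl
sum-+ (suc n) f g = begin
  f 0 ℚ.+ g 0 ℚ.+ sum n (λ i → f (suc i) ℚ.+ g (suc i))          ≡⟨ cong (f 0 ℚ.+ g 0 ℚ.+_) (sum-+ n (f ∘ suc) (g ∘ suc)) ⟩
  f 0 ℚ.+ g 0 ℚ.+ (sum n (f ∘ suc) ℚ.+ sum n (g ∘ suc))          ≡⟨ ℚR.solve 4 (λ a b c d → a ℚR.:+ b ℚR.:+ (c ℚR.:+ d) ℚR.:= a ℚR.:+ c ℚR.:+ (b ℚR.:+ d))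
                                                                      refl (f 0) (g 0) _ _ ⟩
  f 0 ℚ.+ sum n (f ∘ suc) ℚ.+ (g 0 ℚ.+ sum n (g ∘ suc))          ∎

sum-*ˡ : ∀ n a (f : ℕ → ℚ) → sum n (λ i → a ℚ.* f i) ≡ a ℚ.* sum n f
sum-*ˡ zero    a f = sym (ℚ.*-zeroʳ a)
sum-*ˡ (suc n) a f = trans (cong (a ℚ.* f 0 ℚ.+_) (sum-*ˡ n a (f ∘ suc))) (sym (ℚ.*-distribˡ-+ a (f 0) _))

infix 6 _+3_+2_

-- One coefficient of a product with P = 1 + 3x + 2x², formed from three consecutive coefficients of
-- the other factor, highest index first.
_+3_+2_ : ℚ → ℚ → ℚ → ℚ
a +3 b +2 c = a ℚ.+ 3ℚ ℚ.* b ℚ.+ 2ℚ ℚ.* c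

+3+2-cong : ∀ {a a′ b b′ c c′} → a ≡ a′ → b ≡ b′ → c ≡ c′ → a +3 b +2 c ≡ a′ +3 b′ +2 c′
+3+2-cong refl refl refl = refl

sum-+3+2 : ∀ n (f g h : ℕ → ℚ) → sum n (λ i → f i +3 g i +2 h i) ≡ sum n f +3 sum n g +2 sum n h
sum-+3+2 n f g h = begin
  sum n (λ i → f i +3 g i +2 h i)                               ≡⟨ sum-+ n (λ i → f i ℚ.+ 3ℚ ℚ.* g i) (λ i → 2ℚ ℚ.* h i) ⟩
  sum n (λ i → f i ℚ.+ 3ℚ ℚ.* g i) ℚ.+ sum n (λ i → 2ℚ ℚ.* h i) ≡⟨ cong₂ ℚ._+_ (sum-+ n f (λ i → 3ℚ ℚ.* g i)) (sum-*ˡ n 2ℚ h) ⟩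
  sum n f ℚ.+ sum n (λ i → 3ℚ ℚ.* g i) ℚ.+ 2ℚ ℚ.* sum n h       ≡⟨ cong (λ x → sum n f ℚ.+ x ℚ.+ 2ℚ ℚ.* sum n h) (sum-*ˡ n 3ℚ g) ⟩
  sum n f +3 sum n g +2 sum n h                                 ∎

-- Coefficients of polynomials.

coeff-+ : ∀ p q k → coeff (p +ₚ q) k ≡ coeff p k ℚ.+ coeff q k
coeff-+ []      q       k       = sym (ℚ.+-identityˡ _)
coeff-+ (a ∷ p) []      k       = sym (ℚ.+-identityʳ _)
coeff-+ (a ∷ p) (b ∷ q) zero    = refl
coeff-+ (a ∷ p) (b ∷ q) (suc k) = coeff-+ p q k

coeff-neg : ∀ p k → coeff (-ₚ p) k ≡ ℚ.- coeff p k
coeff-neg []      k       = refl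
coeff-neg (a ∷ p) zero    = refl
coeff-neg (a ∷ p) (suc k) = coeff-neg p k

coeff-- : ∀ p q k → coeff (p -ₚ q) k ≡ coeff p k ℚ.- coeff q k
coeff-- p q k = trans (coeff-+ p (-ₚ q) k) (cong (coeff p k ℚ.+_) (coeff-neg q k))

coeff-scale : ∀ a p k → coeff (map (a ℚ.*_) p) k ≡ a ℚ.* coeff p k
coeff-scale a []      k       = sym (ℚ.*-zeroʳ a)
coeff-scale a (b ∷ p) zero    = refl
coeff-scale a (b ∷ p) (suc k) = coeff-scale a p k

coeff-*-zero : ∀ a p q → coeff ((a ∷ p) *ₚ q) 0 ≡ a ℚ.* coeff q 0
coeff-*-zero a p q = begin
  coeff (map (a ℚ.*_) q +ₚ (0ℚ ∷ p *ₚ q)) 0 ≡⟨ coeff-+ (map (a ℚ.*_) q) _ 0 ⟩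
  coeff (map (a ℚ.*_) q) 0 ℚ.+ 0ℚ           ≡⟨ ℚ.+-identityʳ _ ⟩
  coeff (map (a ℚ.*_) q) 0                  ≡⟨ coeff-scale a q 0 ⟩
  a ℚ.* coeff q 0                           ∎

coeff-*-suc : ∀ a p q k → coeff ((a ∷ p) *ₚ q) (suc k) ≡ a ℚ.* coeff q (suc k) ℚ.+ coeff (p *ₚ q) k
coeff-*-suc a p q k = begin
  coeff (map (a ℚ.*_) q +ₚ (0ℚ ∷ p *ₚ q)) (suc k)          ≡⟨ coeff-+ (map (a ℚ.*_) q) _ (suc k) ⟩
  coeff (map (a ℚ.*_) q) (suc k) ℚ.+ coeff (p *ₚ q) k      ≡⟨ cong (ℚ._+ coeff (p *ₚ q) k) (coeff-scale a q (suc k)) ⟩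
  a ℚ.* coeff q (suc k) ℚ.+ coeff (p *ₚ q) k               ∎

coeff-const-* : ∀ a q k → coeff (const a *ₚ q) k ≡ a ℚ.* coeff q k
coeff-const-* a q zero    = coeff-*-zero a [] q
coeff-const-* a q (suc k) = trans (coeff-*-suc a [] q k) (ℚ.+-identityʳ _)

coeff-sum : ∀ n (p : ℕ → ℚ[λ]) k → coeff (foldr _+ₚ_ [] (applyUpTo p n)) k ≡ sum n (λ i → coeff (p i) k)
coeff-sum zero    p k = refl
coeff-sum (suc n) p k = trans (coeff-+ (p 0) _ k) (cong (coeff (p 0) k ℚ.+_) (coeff-sum n (p ∘ suc) k))

coeff-X*-zero : ∀ q → coeff (X *ₚ q) 0 ≡ 0ℚ
coeff-X*-zero q = trans (coeff-*-zero 0ℚ (1ℚ ∷ []) q) (ℚ.*-zeroˡ (coeff q 0))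

coeff-X*-suc : ∀ q k → coeff (X *ₚ q) (suc k) ≡ coeff q k
coeff-X*-suc q k = begin
  coeff (X *ₚ q) (suc k)                                   ≡⟨ coeff-*-suc 0ℚ (1ℚ ∷ []) q k ⟩
  0ℚ ℚ.* coeff q (suc k) ℚ.+ coeff (const 1ℚ *ₚ q) k       ≡⟨ cong₂ ℚ._+_ (ℚ.*-zeroˡ (coeff q (suc k))) (coeff-const-* 1ℚ q k) ⟩
  0ℚ ℚ.+ 1ℚ ℚ.* coeff q k                                  ≡⟨ trans (ℚ.+-identityˡ _) (ℚ.*-identityˡ _) ⟩
  coeff q k                                                ∎

coeff-X^-diagonal : ∀ t → coeff (X ^ₚ t) t ≡ 1ℚ
coeff-X^-diagonal zero    = refl
coeff-X^-diagonal (suc t) = trans (coeff-X*-suc (X ^ₚ t) t) (coeff-X^-diagonal t)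

coeff-X^-≢ : ∀ t k → t ≢ k → coeff (X ^ₚ t) k ≡ 0ℚ
coeff-X^-≢ zero    zero    t≢k with () ← t≢k refl
coeff-X^-≢ zero    (suc k) t≢k = refl
coeff-X^-≢ (suc t) zero    t≢k = coeff-X*-zero (X ^ₚ t)
coeff-X^-≢ (suc t) (suc k) t≢k = trans (coeff-X*-suc (X ^ₚ t) k) (coeff-X^-≢ t k (t≢k ∘ cong suc))

sum-single : ∀ n {k} (f : ℕ → ℚ) → k ℕ.< n → (∀ i → i ≢ k → f i ≡ 0ℚ) → sum n f ≡ f k
sum-single (suc n) {zero}  f k<n f≡0 =
  trans (cong (f 0 ℚ.+_) (sum-zero n λ i _ → f≡0 (suc i) λ ())) (ℚ.+-identityʳ _)
sum-single (suc n) {suc k} f (s≤s k<n) f≡0 =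
  trans (cong₂ ℚ._+_ (f≡0 0 λ ()) (sum-single n (f ∘ suc) k<n λ i i≢k → f≡0 (suc i) (i≢k ∘ ℕ.suc-injective)))
        (ℚ.+-identityˡ _)

polynomial : ℕ → (ℕ → ℚ) → ℚ[λ]
polynomial n a = ∑ₚ[ t from 0 to n ] const (a t) *ₚ X ^ₚ t

coeff-polynomial : ∀ n a k → coeff (polynomial n a) k ≡ sum (suc n) (λ t → a t ℚ.* coeff (X ^ₚ t) k)
coeff-polynomial n a k = trans (coeff-sum (suc n) (λ t → const (a t) *ₚ X ^ₚ t) k) (sum-cong (suc n) λ t _ → coeff-const-* (a t) (X ^ₚ t) k)

scaled-coeff-X^-≢ : ∀ a {t k} → t ≢ k → a ℚ.* coeff (X ^ₚ t) k ≡ 0ℚ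
scaled-coeff-X^-≢ a {t} {k} t≢k = trans (cong (a ℚ.*_) (coeff-X^-≢ t k t≢k)) (ℚ.*-zeroʳ a)

coeff-polynomial-≤ : ∀ n a {k} → k ≤ n → coeff (polynomial n a) k ≡ a k
coeff-polynomial-≤ n a {k} k≤n = begin
  coeff (polynomial n a) k                        ≡⟨ coeff-polynomial n a k ⟩
  sum (suc n) (λ t → a t ℚ.* coeff (X ^ₚ t) k)    ≡⟨ sum-single (suc n) _ (s≤s k≤n) (λ t → scaled-coeff-X^-≢ (a t)) ⟩
  a k ℚ.* coeff (X ^ₚ k) k                        ≡⟨ cong (a k ℚ.*_) (coeff-X^-diagonal k) ⟩
  a k ℚ.* 1ℚ                                      ≡⟨ ℚ.*-identityʳ (a k) ⟩
  a k                                             ∎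

coeff-polynomial-> : ∀ n a {k} → n ℕ.< k → coeff (polynomial n a) k ≡ 0ℚ
coeff-polynomial-> n a {k} n<k = trans (coeff-polynomial n a k)
  (sum-zero (suc n) λ t t<1+n → scaled-coeff-X^-≢ (a t) (ℕ.<⇒≢ (ℕ.<-≤-trans t<1+n n<k)))

-- Since `_≈_` compares coefficients in every degree, the cut-off of the sum at n has to agree with
-- `a` beyond n as well.
coeff-polynomial-supported : ∀ n a → (∀ t → n ℕ.< t → a t ≡ 0ℚ) → ∀ k → coeff (polynomial n a) k ≡ a k
coeff-polynomial-supported n a a≡0 k with k ℕ.≤? n
... | yes k≤n = coeff-polynomial-≤ n a k≤n
... | no  k≰n = trans (coeff-polynomial-> n a (ℕ.≰⇒> k≰n)) (sym (a≡0 k (ℕ.≰⇒> k≰n)))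

-- The series 1/P and recurrences that convolve with it.

γℤ : ℕ → ℤ
γℤ i = -1ℤ ℤ.^ i ℤ.* ((+ 2) ℤ.^ (i ℕ.+ 1) ℤ.- 1ℤ)

γ : ℕ → ℚ
γ i = ι (γℤ i)

-- `γ i` equals 2(-2)ⁱ - (-1)ⁱ, and -1 and -2 are the roots of r² + 3r + 2.
γ-recurrence : ∀ i → γ (2 ℕ.+ i) +3 γ (1 ℕ.+ i) +2 γ i ≡ 0ℚ
γ-recurrence i = begin
  γ (2 ℕ.+ i) ℚ.+ 3ℚ ℚ.* γ (1 ℕ.+ i) ℚ.+ 2ℚ ℚ.* γ i
    ≡⟨ cong₂ (λ x y → γ (2 ℕ.+ i) ℚ.+ x ℚ.+ y) (ι-homo-* (+ 3) (γℤ (1 ℕ.+ i))) (ι-homo-* (+ 2) (γℤ i)) ⟨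
  γ (2 ℕ.+ i) ℚ.+ ι (+ 3 ℤ.* γℤ (1 ℕ.+ i)) ℚ.+ ι (+ 2 ℤ.* γℤ i)
    ≡⟨ cong (ℚ._+ ι (+ 2 ℤ.* γℤ i)) (ι-homo-+ (γℤ (2 ℕ.+ i)) (+ 3 ℤ.* γℤ (1 ℕ.+ i))) ⟨
  ι (γℤ (2 ℕ.+ i) ℤ.+ + 3 ℤ.* γℤ (1 ℕ.+ i)) ℚ.+ ι (+ 2 ℤ.* γℤ i)
    ≡⟨ ι-homo-+ (γℤ (2 ℕ.+ i) ℤ.+ + 3 ℤ.* γℤ (1 ℕ.+ i)) (+ 2 ℤ.* γℤ i) ⟨
  ι (γℤ (2 ℕ.+ i) ℤ.+ + 3 ℤ.* γℤ (1 ℕ.+ i) ℤ.+ + 2 ℤ.* γℤ i)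
    -- The higher powers unfold to multiples of (-1)ⁱ and 2ⁱ⁺¹, so treating these two as variables
    -- leaves a polynomial identity.
    ≡⟨ cong ι (identity (-1ℤ ℤ.^ i) ((+ 2) ℤ.^ (i ℕ.+ 1))) ⟩
  0ℚ ∎
  where
  identity : ∀ u p → -1ℤ ℤ.* (-1ℤ ℤ.* u) ℤ.* (+ 2 ℤ.* (+ 2 ℤ.* p) ℤ.- 1ℤ)
                     ℤ.+ + 3 ℤ.* (-1ℤ ℤ.* u ℤ.* (+ 2 ℤ.* p ℤ.- 1ℤ))
                     ℤ.+ + 2 ℤ.* (u ℤ.* (p ℤ.- 1ℤ)) ≡ + 0
  identity = solve 2 (λ u p →
      con -1ℤ :* (con -1ℤ :* u) :* (con (+ 2) :* (con (+ 2) :* p) :- con 1ℤ)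
      :+ con (+ 3) :* (con -1ℤ :* u :* (con (+ 2) :* p :- con 1ℤ))
      :+ con (+ 2) :* (u :* (p :- con 1ℤ)) := con (+ 0)) refl
    where open ℤR

convolution : (ℕ → ℚ) → (ℕ → ℚ) → ℕ → ℚ
convolution a f n = sum (suc n) λ i → a i ℚ.* f (n ∸ i)

-- The coefficient form of P · (1/P · f) = f.
γ-convolution-inverse : ∀ f n →
  f (2 ℕ.+ n) ≡ convolution γ f (2 ℕ.+ n) +3 convolution γ f (1 ℕ.+ n) +2 convolution γ f n
γ-convolution-inverse f n = sym (begin
  convolution γ f (2 ℕ.+ n) +3 convolution γ f (1 ℕ.+ n) +2 convolution γ f n
    -- Splitting off the leading terms gives all three sums the same length. With γ₀ = 1 and γ₁ =
    -- -3, the contributions of `f (1 ℕ.+ n)` cancel.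
    ≡⟨ rearrange (f (2 ℕ.+ n)) (f (1 ℕ.+ n)) (convolution (γ ∘ (2 ℕ.+_)) f n) (convolution (γ ∘ suc) f n) (convolution γ f n) ⟩
  f (2 ℕ.+ n) ℚ.+ (convolution (γ ∘ (2 ℕ.+_)) f n +3 convolution (γ ∘ suc) f n +2 convolution γ f n)
    ≡⟨ cong (f (2 ℕ.+ n) ℚ.+_) (sum-+3+2 (suc n) (λ i → γ (2 ℕ.+ i) ℚ.* f (n ∸ i)) (λ i → γ (1 ℕ.+ i) ℚ.* f (n ∸ i)) (λ i → γ i ℚ.* f (n ∸ i))) ⟨
  f (2 ℕ.+ n) ℚ.+ sum (suc n) (λ i → γ (2 ℕ.+ i) ℚ.* f (n ∸ i) +3 γ (1 ℕ.+ i) ℚ.* f (n ∸ i) +2 (γ i ℚ.* f (n ∸ i)))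
    ≡⟨ cong (f (2 ℕ.+ n) ℚ.+_) (sum-zero (suc n) λ i _ → vanish i (f (n ∸ i))) ⟩
  f (2 ℕ.+ n) ℚ.+ 0ℚ
    ≡⟨ ℚ.+-identityʳ _ ⟩
  f (2 ℕ.+ n) ∎)
  where
  open ℚR
  rearrange : ∀ x y p q r →
    (γ 0 ℚ.* x ℚ.+ (γ 1 ℚ.* y ℚ.+ p)) +3 (γ 0 ℚ.* y ℚ.+ q) +2 r ≡ x ℚ.+ (p +3 q +2 r)
  rearrange = solve 5 (λ x y p q r →
    (con (γ 0) :* x :+ (con (γ 1) :* y :+ p)) :+ con 3ℚ :* (con (γ 0) :* y :+ q) :+ con 2ℚ :* r
    := x :+ (p :+ con 3ℚ :* q :+ con 2ℚ :* r)) refl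
  vanish : ∀ i x → γ (2 ℕ.+ i) ℚ.* x +3 γ (1 ℕ.+ i) ℚ.* x +2 (γ i ℚ.* x) ≡ 0ℚ
  vanish i x = begin
    γ (2 ℕ.+ i) ℚ.* x +3 γ (1 ℕ.+ i) ℚ.* x +2 (γ i ℚ.* x)
      ≡⟨ solve 4 (λ a b c x → a :* x :+ con 3ℚ :* (b :* x) :+ con 2ℚ :* (c :* x)
                              := (a :+ con 3ℚ :* b :+ con 2ℚ :* c) :* x) refl (γ (2 ℕ.+ i)) (γ (1 ℕ.+ i)) (γ i) x ⟩
    (γ (2 ℕ.+ i) +3 γ (1 ℕ.+ i) +2 γ i) ℚ.* x ≡⟨ cong (ℚ._* x) (γ-recurrence i) ⟩
    0ℚ ℚ.* x                                  ≡⟨ ℚ.*-zeroˡ x ⟩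
    0ℚ                                        ∎

-- Here f is the sequence of coefficients of a fixed λᵏ in cₙ, and g that of the same power in λcₙ.
-- For their generating functions F and G the recurrence says F/P = f₀ - xG, so F = P(f₀ - xG),
-- which involves only three values of g at a time.
module FullHistoryRecurrence
  (f g : ℕ → ℚ)
  (f-rec : ∀ n → f (suc n) ≡ 3ℚ ℚ.* f n ℚ.- g n ℚ.- sum n (λ i → γ (2 ℕ.+ i) ℚ.* f (n ∸ suc i)))
  where

  -- As γ₀ = 1 and γ₁ = -3, collecting all terms in f on one side of the recurrence completes the
  -- convolution.
  γ-convolution : ∀ n → convolution γ f (suc n) ≡ ℚ.- g n
  γ-convolution n = begin
    γ 0 ℚ.* f (suc n) ℚ.+ (γ 1 ℚ.* f n ℚ.+ s)                 ≡⟨ cong (λ x → γ 0 ℚ.* x ℚ.+ (γ 1 ℚ.* f n ℚ.+ s)) (f-rec n) ⟩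
    γ 0 ℚ.* (3ℚ ℚ.* f n ℚ.- g n ℚ.- s) ℚ.+ (γ 1 ℚ.* f n ℚ.+ s) ≡⟨ solve 3 (λ x y s →
        con (γ 0) :* (con 3ℚ :* x :- y :- s) :+ (con (γ 1) :* x :+ s) := :- y) refl (f n) (g n) s ⟩
    ℚ.- g n                                                   ∎
    where
    open ℚR
    s = sum n λ i → γ (2 ℕ.+ i) ℚ.* f (n ∸ suc i)

  f1 : f 1 ≡ 3ℚ ℚ.* f 0 ℚ.- g 0
  f1 = trans (f-rec 0) (ℚ.+-identityʳ _)

  -- Degree 2 is the last one that the term f₀P reaches.
  f2 : f 2 ≡ ℚ.- g 1 ℚ.- 3ℚ ℚ.* g 0 ℚ.+ 2ℚ ℚ.* f 0
  f2 = begin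
    f 2 ≡⟨ γ-convolution-inverse f 0 ⟩
    convolution γ f 2 +3 convolution γ f 1 +2 convolution γ f 0
      ≡⟨ +3+2-cong (γ-convolution 1) (γ-convolution 0) (refl {x = convolution γ f 0}) ⟩
    (ℚ.- g 1) +3 ℚ.- g 0 +2 (γ 0 ℚ.* f 0 ℚ.+ 0ℚ)
      ≡⟨ solve 3 (λ x y z → :- x :+ con 3ℚ :* :- y :+ con 2ℚ :* (con (γ 0) :* z :+ con 0ℚ)
                           := :- x :- con 3ℚ :* y :+ con 2ℚ :* z) refl (g 1) (g 0) (f 0) ⟩
    ℚ.- g 1 ℚ.- 3ℚ ℚ.* g 0 ℚ.+ 2ℚ ℚ.* f 0 ∎
    where open ℚR

  f3+ : ∀ n → f (3 ℕ.+ n) ≡ ℚ.- (g (2 ℕ.+ n) +3 g (1 ℕ.+ n) +2 g n)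
  f3+ n = begin
    f (3 ℕ.+ n) ≡⟨ γ-convolution-inverse f (suc n) ⟩
    convolution γ f (3 ℕ.+ n) +3 convolution γ f (2 ℕ.+ n) +2 convolution γ f (1 ℕ.+ n)
      ≡⟨ +3+2-cong (γ-convolution (2 ℕ.+ n)) (γ-convolution (1 ℕ.+ n)) (γ-convolution n) ⟩
    (ℚ.- g (2 ℕ.+ n)) +3 ℚ.- g (1 ℕ.+ n) +2 (ℚ.- g n)
      ≡⟨ solve 3 (λ x y z → :- x :+ con 3ℚ :* :- y :+ con 2ℚ :* :- z
                           := :- (x :+ con 3ℚ :* y :+ con 2ℚ :* z)) refl (g (2 ℕ.+ n)) (g (1 ℕ.+ n)) (g n) ⟩
    ℚ.- (g (2 ℕ.+ n) +3 g (1 ℕ.+ n) +2 g n) ∎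
    where open ℚR

  -- With f₀ = 0 what remains is F = -xPG. Extending g by zero to negative indices lets one formula
  -- cover the first three values too.
  f-shift : (D : ℤ → ℚ) → (∀ n → g n ≡ D (+ n)) → (∀ m → D -[1+ m ] ≡ 0ℚ) → f 0 ≡ 0ℚ →
    ∀ n → f n ≡ ℚ.- (D (+ n ℤ.- 1ℤ) +3 D (+ n ℤ.- + 2) +2 D (+ n ℤ.- + 3))
  f-shift D g≡D D-neg f0≡0 0 = trans f0≡0 (cong ℚ.-_ (sym (+3+2-cong (D-neg 0) (D-neg 1) (D-neg 2))))
  f-shift D g≡D D-neg f0≡0 1 = begin
    f 1                              ≡⟨ f1 ⟩
    3ℚ ℚ.* f 0 ℚ.- g 0               ≡⟨ cong (λ x → 3ℚ ℚ.* x ℚ.- g 0) f0≡0 ⟩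
    3ℚ ℚ.* 0ℚ ℚ.- g 0                ≡⟨ solve 1 (λ x → con 3ℚ :* con 0ℚ :- x :=
                                          :- (x :+ con 3ℚ :* con 0ℚ :+ con 2ℚ :* con 0ℚ)) refl (g 0) ⟩
    ℚ.- (g 0 +3 0ℚ +2 0ℚ)            ≡⟨ cong ℚ.-_ (+3+2-cong (g≡D 0) (sym (D-neg 0)) (sym (D-neg 1))) ⟩
    ℚ.- (D (+ 0) +3 D -[1+ 0 ] +2 D -[1+ 1 ]) ∎
    where open ℚR
  f-shift D g≡D D-neg f0≡0 2 = begin
    f 2                                      ≡⟨ f2 ⟩
    ℚ.- g 1 ℚ.- 3ℚ ℚ.* g 0 ℚ.+ 2ℚ ℚ.* f 0    ≡⟨ cong (λ x → ℚ.- g 1 ℚ.- 3ℚ ℚ.* g 0 ℚ.+ 2ℚ ℚ.* x) f0≡0 ⟩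
    ℚ.- g 1 ℚ.- 3ℚ ℚ.* g 0 ℚ.+ 2ℚ ℚ.* 0ℚ     ≡⟨ solve 2 (λ x y → :- x :- con 3ℚ :* y :+ con 2ℚ :* con 0ℚ :=
                                                  :- (x :+ con 3ℚ :* y :+ con 2ℚ :* con 0ℚ)) refl (g 1) (g 0) ⟩
    ℚ.- (g 1 +3 g 0 +2 0ℚ)                   ≡⟨ cong ℚ.-_ (+3+2-cong (g≡D 1) (g≡D 0) (sym (D-neg 0))) ⟩
    ℚ.- (D (+ 1) +3 D (+ 0) +2 D -[1+ 0 ])   ∎
    where open ℚR
  f-shift D g≡D D-neg f0≡0 (suc (suc (suc n))) = trans (f3+ n)
    (cong ℚ.-_ (+3+2-cong (g≡D (2 ℕ.+ n)) (g≡D (1 ℕ.+ n)) (g≡D n)))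

-- The rule in t for the closed form.

binom-pascal : ∀ a z → binom (suc a) z ≡ binom a z ℕ.+ binom a (z ℤ.- 1ℤ)
-- The second term has lower index -1 and is 0 by convention, so Pascal's rule holds at this
-- boundary as well.
binom-pascal a (+ zero)    = refl
binom-pascal a (+ suc k)   = trans (sym (nCk+nC[k+1]≡[n+1]C[k+1] a k)) (ℕ.+-comm (a C k) (a C suc k))
binom-pascal a -[1+ n ]    = refl

ι-binom-pascal : ∀ a z → ι (+ binom (suc a) z) ≡ ι (+ binom a z) ℚ.+ ι (+ binom a (z ℤ.- 1ℤ))
ι-binom-pascal a z = trans (cong (λ b → ι (+ b)) (binom-pascal a z)) (ι-homo-+ (+ binom a z) (+ binom a (z ℤ.- 1ℤ)))

3^-pred : ∀ z → 3ℚ ℚ.* 3ℚ ^ℤ (z ℤ.- 1ℤ) ≡ 3ℚ ^ℤ z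
3^-pred (+ zero)  = refl
3^-pred (+ suc n) = refl
3^-pred -[1+ n ]  = begin
  -- Integer subtraction computes to an exponent containing `n ℕ.+ 0`, which is simplified first.
  3ℚ ℚ.* 3ℚ ^ℤ (-[1+ n ] ℤ.- 1ℤ)                       ≡⟨ cong (λ m → 3ℚ ℚ.* (ℚ.1/ 3ℚ) ^ℚ suc (suc m)) (ℕ.+-identityʳ n) ⟩
  3ℚ ℚ.* (ℚ.1/ 3ℚ ℚ.* (ℚ.1/ 3ℚ) ^ℚ suc n)              ≡⟨ solve 1 (λ x → con 3ℚ :* (con (ℚ.1/ 3ℚ) :* x) := x) refl ((ℚ.1/ 3ℚ) ^ℚ suc n) ⟩
  (ℚ.1/ 3ℚ) ^ℚ suc n                                   ∎
  where open ℚR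

-- The coefficient of xᵉ in (1 + 3x)^ℓ ((1 + 3x) + 2x²).
seed : ℕ → ℤ → ℚ
seed ℓ e = 3ℚ ^ℤ (e ℤ.- + 2) ℚ.* (2ℚ ℚ.* ι (+ binom ℓ (e ℤ.- + 2)) ℚ.+ 9ℚ ℚ.* ι (+ binom (ℓ ℕ.+ 1) e))

-- Multiplication by 1 + 3x, obtained from Pascal's rule in both binomials.
seed-suc : ∀ ℓ e → seed (suc ℓ) e ≡ seed ℓ e ℚ.+ 3ℚ ℚ.* seed ℓ (e ℤ.- 1ℤ)
seed-suc ℓ e = begin
  seed (suc ℓ) e
    ≡⟨ cong₂ (λ x y → 3ℚ ^ℤ e₂ ℚ.* (2ℚ ℚ.* x ℚ.+ 9ℚ ℚ.* y)) (ι-binom-pascal ℓ e₂) (ι-binom-pascal (ℓ ℕ.+ 1) e) ⟩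
  3ℚ ^ℤ e₂ ℚ.* (2ℚ ℚ.* (p ℚ.+ p′) ℚ.+ 9ℚ ℚ.* (q ℚ.+ q′))
    -- The two seeds on the right carry 3 to the powers e - 2 and e - 3; both are expressed through
    -- the smaller power `w`.
    ≡⟨ cong (ℚ._* (2ℚ ℚ.* (p ℚ.+ p′) ℚ.+ 9ℚ ℚ.* (q ℚ.+ q′))) (3^-pred e₂) ⟨
  3ℚ ℚ.* w ℚ.* (2ℚ ℚ.* (p ℚ.+ p′) ℚ.+ 9ℚ ℚ.* (q ℚ.+ q′))
    ≡⟨ solve 5 (λ w p p′ q q′ → con 3ℚ :* w :* (con 2ℚ :* (p :+ p′) :+ con 9ℚ :* (q :+ q′))
                 := con 3ℚ :* w :* (con 2ℚ :* p :+ con 9ℚ :* q) :+ con 3ℚ :* (w :* (con 2ℚ :* p′ :+ con 9ℚ :* q′)))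
               refl w p p′ q q′ ⟩
  3ℚ ℚ.* w ℚ.* (2ℚ ℚ.* p ℚ.+ 9ℚ ℚ.* q) ℚ.+ 3ℚ ℚ.* (w ℚ.* (2ℚ ℚ.* p′ ℚ.+ 9ℚ ℚ.* q′))
    ≡⟨ cong₂ (λ x y → x ℚ.* (2ℚ ℚ.* p ℚ.+ 9ℚ ℚ.* q) ℚ.+ 3ℚ ℚ.* (3ℚ ^ℤ y ℚ.* (2ℚ ℚ.* ι (+ binom ℓ y) ℚ.+ 9ℚ ℚ.* q′)))
             (3^-pred e₂) (ℤR.solve 1 (λ e → e ℤR.:- ℤR.con (+ 2) ℤR.:- ℤR.con 1ℤ ℤR.:= e ℤR.:- ℤR.con 1ℤ ℤR.:- ℤR.con (+ 2)) refl e) ⟩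
  seed ℓ e ℚ.+ 3ℚ ℚ.* seed ℓ (e ℤ.- 1ℤ) ∎
  where
  open ℚR
  e₂ = e ℤ.- + 2
  w  = 3ℚ ^ℤ (e₂ ℤ.- 1ℤ)
  p  = ι (+ binom ℓ e₂)
  p′ = ι (+ binom ℓ (e₂ ℤ.- 1ℤ))
  q  = ι (+ binom (ℓ ℕ.+ 1) e)
  q′ = ι (+ binom (ℓ ℕ.+ 1) (e ℤ.- 1ℤ))

-- Pascal's rule splits row t + 1 into two copies of row t, one of them shifted by one place;
-- reindexing that copy pairs `g (suc ℓ)` with `g ℓ`.
sum-pascal : ∀ t (g : ℕ → ℚ) →
  sum (2 ℕ.+ t) (λ ℓ → ι (+ (suc t C ℓ)) ℚ.* g ℓ) ≡ sum (suc t) (λ ℓ → ι (+ (t C ℓ)) ℚ.* (g (suc ℓ) ℚ.+ g ℓ))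
sum-pascal t g = begin
  b (suc t) 0 ℚ.* g 0 ℚ.+ sum (suc t) (λ ℓ → b (suc t) (suc ℓ) ℚ.* g (suc ℓ))
    ≡⟨ cong (b t 0 ℚ.* g 0 ℚ.+_) (sum-cong (suc t) λ ℓ _ → split ℓ) ⟩
  b t 0 ℚ.* g 0 ℚ.+ sum (suc t) (λ ℓ → b t (suc ℓ) ℚ.* g (suc ℓ) ℚ.+ b t ℓ ℚ.* g (suc ℓ))
    ≡⟨ cong (b t 0 ℚ.* g 0 ℚ.+_) (sum-+ (suc t) (λ ℓ → b t (suc ℓ) ℚ.* g (suc ℓ)) (λ ℓ → b t ℓ ℚ.* g (suc ℓ))) ⟩
  b t 0 ℚ.* g 0 ℚ.+ (sum (suc t) (λ ℓ → b t (suc ℓ) ℚ.* g (suc ℓ)) ℚ.+ u)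
    ≡⟨ ℚ.+-assoc (b t 0 ℚ.* g 0) _ u ⟨
  sum (2 ℕ.+ t) (λ ℓ → b t ℓ ℚ.* g ℓ) ℚ.+ u
    ≡⟨ cong (ℚ._+ u) (sum-last (suc t) (λ ℓ → b t ℓ ℚ.* g ℓ)) ⟩
  v ℚ.+ b t (suc t) ℚ.* g (suc t) ℚ.+ u
    -- The unshifted copy runs one place past the end of row t, where the binomial is 0.
    ≡⟨ cong (λ k → v ℚ.+ ι (+ k) ℚ.* g (suc t) ℚ.+ u) (k>n⇒nCk≡0 (ℕ.n<1+n t)) ⟩
  v ℚ.+ 0ℚ ℚ.* g (suc t) ℚ.+ u
    ≡⟨ ℚR.solve 3 (λ v x u → v ℚR.:+ ℚR.con 0ℚ ℚR.:* x ℚR.:+ u ℚR.:= u ℚR.:+ v) refl v (g (suc t)) u ⟩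
  u ℚ.+ v
    ≡⟨ sum-+ (suc t) (λ ℓ → b t ℓ ℚ.* g (suc ℓ)) (λ ℓ → b t ℓ ℚ.* g ℓ) ⟨
  sum (suc t) (λ ℓ → b t ℓ ℚ.* g (suc ℓ) ℚ.+ b t ℓ ℚ.* g ℓ)
    ≡⟨ sum-cong (suc t) (λ ℓ _ → ℚ.*-distribˡ-+ (b t ℓ) (g (suc ℓ)) (g ℓ)) ⟨
  sum (suc t) (λ ℓ → b t ℓ ℚ.* (g (suc ℓ) ℚ.+ g ℓ)) ∎
  where
  b : ℕ → ℕ → ℚ
  b a k = ι (+ (a C k))
  u = sum (suc t) λ ℓ → b t ℓ ℚ.* g (suc ℓ)
  v = sum (suc t) λ ℓ → b t ℓ ℚ.* g ℓ
  split : ∀ ℓ → b (suc t) (suc ℓ) ℚ.* g (suc ℓ) ≡ b t (suc ℓ) ℚ.* g (suc ℓ) ℚ.+ b t ℓ ℚ.* g (suc ℓ)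
  split ℓ = trans (cong (ℚ._* g (suc ℓ)) (ι-binom-pascal t (+ suc ℓ))) (ℚ.*-distribʳ-+ (g (suc ℓ)) (b t (suc ℓ)) (b t ℓ))

-- The degree left for `seed ℓ` in xᶻ once (-x)ᵗ and (2x²)ᵗ⁻ˡ, with l = `ℓ`, have taken t + 2(t -
-- ℓ).
exponent : ℤ → ℕ → ℕ → ℤ
exponent z t ℓ = z ℤ.+ + 2 ℤ.* + ℓ ℤ.- + 3 ℤ.* + t

summand : ℕ → ℤ → ℕ → ℚ
summand t z ℓ = ι (+ binom t (+ ℓ)) ℚ.* ι -1ℤ ^ℚ t ℚ.* 2ℚ ^ℚ (t ∸ ℓ)
  ℚ.* 3ℚ ^ℤ (exponent z t ℓ ℤ.- + 2)
  ℚ.* (2ℚ ℚ.* ι (+ binom ℓ (exponent z t ℓ ℤ.- + 2)) ℚ.+ 9ℚ ℚ.* ι (+ binom (ℓ ℕ.+ 1) (exponent z t ℓ)))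

-- The coefficient of λᵗ xᶻ in C, with z an integer so that shifting z never truncates.
closedForm : ℕ → ℤ → ℚ
closedForm t z = ∑ℚ[ ℓ from 0 to t ] summand t z ℓ

-- Multiplication by -xP, split as -x(1 + 3x) and -x · 2x². In the pairs from `sum-pascal`, index
-- `suc ℓ` supplies the factor 1 + 3x, hence the shifts by 1 and 2, and index `ℓ` supplies 2x²,
-- hence the shift by 3.
closedForm-suc : ∀ t z →
  closedForm (suc t) z ≡ ℚ.- (closedForm t (z ℤ.- 1ℤ) +3 closedForm t (z ℤ.- + 2) +2 closedForm t (z ℤ.- + 3))
closedForm-suc t z = begin
  closedForm (suc t) z
    ≡⟨ sum-cong (2 ℕ.+ t) (λ ℓ _ → summand-seed (suc t) z ℓ) ⟩
  sum (2 ℕ.+ t) (λ ℓ → ι (+ (suc t C ℓ)) ℚ.* g (suc t) z ℓ)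
    ≡⟨ sum-pascal t (g (suc t) z) ⟩
  sum (suc t) (λ ℓ → ι (+ (t C ℓ)) ℚ.* (g (suc t) z (suc ℓ) ℚ.+ g (suc t) z ℓ))
    ≡⟨ sum-cong (suc t) (λ ℓ ℓ<1+t → step ℓ (ℕ.s≤s⁻¹ ℓ<1+t)) ⟩
  sum (suc t) (λ ℓ → ι -1ℤ ℚ.* (S 1 ℓ +3 S 2 ℓ +2 S 3 ℓ))
    ≡⟨ sum-*ˡ (suc t) (ι -1ℤ) (λ ℓ → S 1 ℓ +3 S 2 ℓ +2 S 3 ℓ) ⟩
  ι -1ℤ ℚ.* sum (suc t) (λ ℓ → S 1 ℓ +3 S 2 ℓ +2 S 3 ℓ)
    ≡⟨ cong (ι -1ℤ ℚ.*_) (sum-+3+2 (suc t) (S 1) (S 2) (S 3)) ⟩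
  ι -1ℤ ℚ.* (sum (suc t) (S 1) +3 sum (suc t) (S 2) +2 sum (suc t) (S 3))
    ≡⟨ solve 1 (λ x → con (ι -1ℤ) :* x := :- x) refl (sum (suc t) (S 1) +3 sum (suc t) (S 2) +2 sum (suc t) (S 3)) ⟩
  ℚ.- (closedForm t (z ℤ.- 1ℤ) +3 closedForm t (z ℤ.- + 2) +2 closedForm t (z ℤ.- + 3)) ∎
  where
  open ℚR
  S : ℕ → ℕ → ℚ
  S j = summand t (z ℤ.- + j)

  g : ℕ → ℤ → ℕ → ℚ
  g t z ℓ = ι -1ℤ ^ℚ t ℚ.* 2ℚ ^ℚ (t ∸ ℓ) ℚ.* seed ℓ (exponent z t ℓ)

  summand-seed : ∀ t z ℓ → summand t z ℓ ≡ ι (+ (t C ℓ)) ℚ.* g t z ℓ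
  summand-seed t z ℓ = solve 5 (λ b s p w x → b :* s :* p :* w :* x := b :* (s :* p :* (w :* x))) refl
    (ι (+ (t C ℓ))) (ι -1ℤ ^ℚ t) (2ℚ ^ℚ (t ∸ ℓ)) (3ℚ ^ℤ (exponent z t ℓ ℤ.- + 2)) _

  shift₁ : ∀ ℓ → exponent z (suc t) (suc ℓ) ≡ exponent (z ℤ.- 1ℤ) t ℓ
  shift₁ ℓ = ℤR.solve 3 (λ z l t →
    z ℤR.:+ ℤR.con (+ 2) ℤR.:* (ℤR.con 1ℤ ℤR.:+ l) ℤR.:- ℤR.con (+ 3) ℤR.:* (ℤR.con 1ℤ ℤR.:+ t)
    ℤR.:= z ℤR.:- ℤR.con 1ℤ ℤR.:+ ℤR.con (+ 2) ℤR.:* l ℤR.:- ℤR.con (+ 3) ℤR.:* t) refl z (+ ℓ) (+ t)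

  shift₂ : ∀ ℓ → exponent (z ℤ.- 1ℤ) t ℓ ℤ.- 1ℤ ≡ exponent (z ℤ.- + 2) t ℓ
  shift₂ ℓ = ℤR.solve 3 (λ z l t →
    z ℤR.:- ℤR.con 1ℤ ℤR.:+ ℤR.con (+ 2) ℤR.:* l ℤR.:- ℤR.con (+ 3) ℤR.:* t ℤR.:- ℤR.con 1ℤ
    ℤR.:= z ℤR.:- ℤR.con (+ 2) ℤR.:+ ℤR.con (+ 2) ℤR.:* l ℤR.:- ℤR.con (+ 3) ℤR.:* t) refl z (+ ℓ) (+ t)

  shift₃ : ∀ ℓ → exponent z (suc t) ℓ ≡ exponent (z ℤ.- + 3) t ℓ
  shift₃ ℓ = ℤR.solve 3 (λ z l t →
    z ℤR.:+ ℤR.con (+ 2) ℤR.:* l ℤR.:- ℤR.con (+ 3) ℤR.:* (ℤR.con 1ℤ ℤR.:+ t)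
    ℤR.:= z ℤR.:- ℤR.con (+ 3) ℤR.:+ ℤR.con (+ 2) ℤR.:* l ℤR.:- ℤR.con (+ 3) ℤR.:* t) refl z (+ ℓ) (+ t)

  step : ∀ ℓ → ℓ ≤ t →
    ι (+ (t C ℓ)) ℚ.* (g (suc t) z (suc ℓ) ℚ.+ g (suc t) z ℓ) ≡ ι -1ℤ ℚ.* (S 1 ℓ +3 S 2 ℓ +2 S 3 ℓ)
  step ℓ ℓ≤t = begin
    b ℚ.* (ι -1ℤ ℚ.* s ℚ.* p ℚ.* seed (suc ℓ) (exponent z (suc t) (suc ℓ)) ℚ.+
           ι -1ℤ ℚ.* s ℚ.* 2ℚ ^ℚ (suc t ∸ ℓ) ℚ.* seed ℓ (exponent z (suc t) ℓ))
      -- The bound ℓ ≤ t makes `suc t ∸ ℓ` a successor, which releases the factor 2 of 2x².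
      ≡⟨ cong₂ (λ x y → b ℚ.* (ι -1ℤ ℚ.* s ℚ.* p ℚ.* x ℚ.+ ι -1ℤ ℚ.* s ℚ.* 2ℚ ^ℚ y ℚ.* seed ℓ (exponent z (suc t) ℓ)))
               seed-eq (ℕ.+-∸-assoc 1 ℓ≤t) ⟩
    b ℚ.* (ι -1ℤ ℚ.* s ℚ.* p ℚ.* (x₁ ℚ.+ 3ℚ ℚ.* x₂) ℚ.+ ι -1ℤ ℚ.* s ℚ.* (2ℚ ℚ.* p) ℚ.* seed ℓ (exponent z (suc t) ℓ))
      ≡⟨ cong (λ e → b ℚ.* (ι -1ℤ ℚ.* s ℚ.* p ℚ.* (x₁ ℚ.+ 3ℚ ℚ.* x₂) ℚ.+ ι -1ℤ ℚ.* s ℚ.* (2ℚ ℚ.* p) ℚ.* seed ℓ e)) (shift₃ ℓ) ⟩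
    b ℚ.* (ι -1ℤ ℚ.* s ℚ.* p ℚ.* (x₁ ℚ.+ 3ℚ ℚ.* x₂) ℚ.+ ι -1ℤ ℚ.* s ℚ.* (2ℚ ℚ.* p) ℚ.* x₃)
      ≡⟨ solve 6 (λ b s p x₁ x₂ x₃ →
           b :* (con (ι -1ℤ) :* s :* p :* (x₁ :+ con 3ℚ :* x₂) :+ con (ι -1ℤ) :* s :* (con 2ℚ :* p) :* x₃)
           := con (ι -1ℤ) :* (b :* (s :* p :* x₁) :+ con 3ℚ :* (b :* (s :* p :* x₂)) :+ con 2ℚ :* (b :* (s :* p :* x₃))))
           refl b s p x₁ x₂ x₃ ⟩
    ι -1ℤ ℚ.* (b ℚ.* (s ℚ.* p ℚ.* x₁) +3 b ℚ.* (s ℚ.* p ℚ.* x₂) +2 (b ℚ.* (s ℚ.* p ℚ.* x₃)))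
      ≡⟨ cong (ι -1ℤ ℚ.*_) (+3+2-cong (summand-seed t (z ℤ.- 1ℤ) ℓ) (summand-seed t (z ℤ.- + 2) ℓ) (summand-seed t (z ℤ.- + 3) ℓ)) ⟨
    ι -1ℤ ℚ.* (S 1 ℓ +3 S 2 ℓ +2 S 3 ℓ) ∎
    where
    b = ι (+ (t C ℓ))
    s = ι -1ℤ ^ℚ t
    p = 2ℚ ^ℚ (t ∸ ℓ)
    x₁ = seed ℓ (exponent (z ℤ.- 1ℤ) t ℓ)
    x₂ = seed ℓ (exponent (z ℤ.- + 2) t ℓ)
    x₃ = seed ℓ (exponent (z ℤ.- + 3) t ℓ)
    seed-eq : seed (suc ℓ) (exponent z (suc t) (suc ℓ)) ≡ x₁ ℚ.+ 3ℚ ℚ.* x₂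
    seed-eq = begin
      seed (suc ℓ) (exponent z (suc t) (suc ℓ))   ≡⟨ cong (seed (suc ℓ)) (shift₁ ℓ) ⟩
      seed (suc ℓ) (exponent (z ℤ.- 1ℤ) t ℓ)      ≡⟨ seed-suc ℓ (exponent (z ℤ.- 1ℤ) t ℓ) ⟩
      x₁ ℚ.+ 3ℚ ℚ.* seed ℓ (exponent (z ℤ.- 1ℤ) t ℓ ℤ.- 1ℤ) ≡⟨ cong (λ e → x₁ ℚ.+ 3ℚ ℚ.* seed ℓ e) (shift₂ ℓ) ⟩
      x₁ ℚ.+ 3ℚ ℚ.* x₂                            ∎

-- Where the closed form vanishes.

closedForm-0 : ∀ z → ι (+ binom 0 (exponent z 0 0 ℤ.- + 2)) ≡ 0ℚ → ι (+ binom 1 (exponent z 0 0)) ≡ 0ℚ →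
  closedForm 0 z ≡ 0ℚ
closedForm-0 z eq₁ eq₂ = begin
  closedForm 0 z                                  ≡⟨ cong₂ (λ x y → w ℚ.* (2ℚ ℚ.* x ℚ.+ 9ℚ ℚ.* y) ℚ.+ 0ℚ) eq₁ eq₂ ⟩
  w ℚ.* (2ℚ ℚ.* 0ℚ ℚ.+ 9ℚ ℚ.* 0ℚ) ℚ.+ 0ℚ          ≡⟨ solve 1 (λ w → w :* con 0ℚ :+ con 0ℚ := con 0ℚ) refl w ⟩
  0ℚ                                              ∎
  where
  open ℚR
  w = 1ℚ ℚ.* 3ℚ ^ℤ (exponent z 0 0 ℤ.- + 2)

closedForm-0-3+ : ∀ n → closedForm 0 (+ (3 ℕ.+ n)) ≡ 0ℚ
closedForm-0-3+ n = closedForm-0 (+ (3 ℕ.+ n)) refl refl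

-- The series (-x)ᵗPᵗ⁺¹ starts at xᵗ. This gives both the zero extension to negative z and the
-- cut-off of cₙ at degree n.
closedForm-vanishes : ∀ t z → z ℤ.< + t → closedForm t z ≡ 0ℚ
closedForm-vanishes zero    -[1+ n ] _   = closedForm-0 -[1+ n ] refl refl
closedForm-vanishes zero    (+ n) (ℤ.+<+ ())
closedForm-vanishes (suc t) z        z<1+t = begin
  closedForm (suc t) z ≡⟨ closedForm-suc t z ⟩
  ℚ.- (closedForm t (z ℤ.- 1ℤ) +3 closedForm t (z ℤ.- + 2) +2 closedForm t (z ℤ.- + 3))
    ≡⟨ cong ℚ.-_ (+3+2-cong (vanishes 0) (vanishes 1) (vanishes 2)) ⟩
  0ℚ ∎
  where
  vanishes : ∀ j → closedForm t (z ℤ.+ -[1+ j ]) ≡ 0ℚ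
  -- Each shift lowers z by at least 1, enough to match the drop from t + 1 to t.
  vanishes j = closedForm-vanishes t _ (ℤ.+-mono-<-≤ z<1+t (ℤ.-≤- z≤n))

-- The recurrence read coefficientwise, and its solution.

3-X-*-zero : ∀ q → coeff ((const 3ℚ -ₚ X) *ₚ q) 0 ≡ 3ℚ ℚ.* coeff q 0 ℚ.- 0ℚ
3-X-*-zero q = trans (coeff-*-zero 3ℚ (ι -1ℤ ∷ []) q) (sym (ℚ.+-identityʳ _))

3-X-*-suc : ∀ q k → coeff ((const 3ℚ -ₚ X) *ₚ q) (suc k) ≡ 3ℚ ℚ.* coeff q (suc k) ℚ.- coeff q k
3-X-*-suc q k = begin
  coeff ((const 3ℚ -ₚ X) *ₚ q) (suc k)                             ≡⟨ coeff-*-suc 3ℚ (ι -1ℤ ∷ []) q k ⟩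
  3ℚ ℚ.* coeff q (suc k) ℚ.+ coeff (const (ι -1ℤ) *ₚ q) k          ≡⟨ cong (3ℚ ℚ.* coeff q (suc k) ℚ.+_) (coeff-const-* (ι -1ℤ) q k) ⟩
  3ℚ ℚ.* coeff q (suc k) ℚ.+ ι -1ℤ ℚ.* coeff q k                   ≡⟨ solve 2 (λ x y → con 3ℚ :* x :+ con (ι -1ℤ) :* y := con 3ℚ :* x :- y)
                                                                       refl (coeff q (suc k)) (coeff q k) ⟩
  3ℚ ℚ.* coeff q (suc k) ℚ.- coeff q k                             ∎
  where open ℚR

module _
  (c : ℕ → ℚ[λ])
  (c-zero : c 0 ≈ 1ₚ)
  (c-rec : ∀ n → 1 ≤ n →
      c n ≈ (const (ι (+ 3)) -ₚ X) *ₚ c (n ∸ 1)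
            -ₚ (∑ₚ[ i from 2 to n ]
                  const (ι (-1ℤ ℤ.^ i ℤ.* ((+ 2) ℤ.^ (i ℕ.+ 1) ℤ.- 1ℤ))) *ₚ c (n ∸ i)))
  where

  cₖ : ℕ → ℕ → ℚ
  cₖ k n = coeff (c n) k

  -- The coefficient of λᵏ in λcₙ, which takes the role of g.
  Xcₖ : ℕ → ℕ → ℚ
  Xcₖ zero    n = 0ℚ
  Xcₖ (suc k) n = cₖ k n

  coeff-3-X-* : ∀ k n → coeff ((const 3ℚ -ₚ X) *ₚ c n) k ≡ 3ℚ ℚ.* cₖ k n ℚ.- Xcₖ k n
  coeff-3-X-* zero    n = 3-X-*-zero (c n)
  coeff-3-X-* (suc k) n = 3-X-*-suc (c n) k

  coeff-c-rec : ∀ k n → cₖ k (suc n) ≡ 3ℚ ℚ.* cₖ k n ℚ.- Xcₖ k n ℚ.- sum n (λ i → γ (2 ℕ.+ i) ℚ.* cₖ k (n ∸ suc i))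
  coeff-c-rec k n = begin
    cₖ k (suc n)
      ≡⟨ c-rec (suc n) (s≤s z≤n) k ⟩
    coeff ((const 3ℚ -ₚ X) *ₚ c n -ₚ foldr _+ₚ_ [] (applyUpTo history n)) k
      ≡⟨ coeff-- ((const 3ℚ -ₚ X) *ₚ c n) _ k ⟩
    coeff ((const 3ℚ -ₚ X) *ₚ c n) k ℚ.- coeff (foldr _+ₚ_ [] (applyUpTo history n)) k
      ≡⟨ cong₂ ℚ._-_ (coeff-3-X-* k n) (trans (coeff-sum n history k) (sum-cong n λ i _ → coeff-const-* (γ (2 ℕ.+ i)) (c (n ∸ suc i)) k)) ⟩
    3ℚ ℚ.* cₖ k n ℚ.- Xcₖ k n ℚ.- sum n (λ i → γ (2 ℕ.+ i) ℚ.* cₖ k (n ∸ suc i)) ∎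
    where
    history : ℕ → ℚ[λ]
    history i = const (γ (2 ℕ.+ i)) *ₚ c (n ∸ suc i)

  -- Induction on the power of λ, for all n at once: both sides pass from k to k + 1 by
  -- multiplication with -xP.
  coeff≡closedForm : ∀ k n → cₖ k n ≡ closedForm k (+ n)
  coeff≡closedForm zero = base
    where
    open FullHistoryRecurrence (cₖ 0) (Xcₖ 0) (coeff-c-rec 0)
    base : ∀ n → cₖ 0 n ≡ closedForm 0 (+ n)
    -- With g = 0 and f₀ = 1 the sequence is 1, 3, 2, 0, 0, ..., the coefficients of P.
    base 0 = c-zero 0
    base 1 = trans f1 (cong (λ x → 3ℚ ℚ.* x ℚ.- 0ℚ) (c-zero 0))
    base 2 = trans f2 (cong (λ x → 0ℚ ℚ.+ 2ℚ ℚ.* x) (c-zero 0))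
    base (suc (suc (suc n))) = trans (f3+ n) (sym (closedForm-0-3+ n))
  coeff≡closedForm (suc k) n = trans
    (f-shift (closedForm k) (coeff≡closedForm k)
             (λ m → closedForm-vanishes k -[1+ m ] ℤ.-<+) (c-zero (suc k)) n)
    (sym (closedForm-suc k (+ n)))
    where open FullHistoryRecurrence (cₖ (suc k)) (cₖ k) (coeff-c-rec (suc k))

theorem13 :
    (c : ℕ → ℚ[λ]) →
    c 0 ≈ 1ₚ →
    (∀ n → 1 ≤ n →
      c n ≈ (const (ι (+ 3)) -ₚ X) *ₚ c (n ∸ 1)
            -ₚ (∑ₚ[ i from 2 to n ]
                  const (ι (-1ℤ ℤ.^ i ℤ.* ((+ 2) ℤ.^ (i ℕ.+ 1) ℤ.- 1ℤ))) *ₚ c (n ∸ i))) →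
    ∀ n →
      c n ≈ (∑ₚ[ t from 0 to n ]
              const (∑ℚ[ ℓ from 0 to t ]
                (let e = + n ℤ.+ + 2 ℤ.* + ℓ ℤ.- + 3 ℤ.* + t in
                 ι (+ binom t (+ ℓ)) ℚ.* ι -1ℤ ^ℚ t ℚ.* ι (+ 2) ^ℚ (t ∸ ℓ)
                 ℚ.* ι (+ 3) ^ℤ (e ℤ.- + 2)
                 ℚ.* (ι (+ 2) ℚ.* ι (+ binom ℓ (e ℤ.- + 2))
                      ℚ.+ ι (+ 9) ℚ.* ι (+ binom (ℓ ℕ.+ 1) e))))
              *ₚ X ^ₚ t)
theorem13 c c-zero c-rec n k = trans (coeff≡closedForm c c-zero c-rec k n)
  (sym (coeff-polynomial-supported n (λ t → closedForm t (+ n)) (λ t n<t → closedForm-vanishes t (+ n) (ℤ.+<+ n<t)) k))
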